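{- Let $p,n,d,q,r,s$ be natural numbers with $64<p\le126$, $n,d,q,r<2^{128}$, and $s\in\{p,p+1\}$. If the native quotient certificate accepts the pair $(q,r)$ for the shifted numerator $n2^s$ and divisor $d$, then $$q=\left\lfloor n2^s/d\right\rfloor,\qquad r=(n2^s)\bmod d.$$
   Context: The values $n,d,q,r$ are stored as 128-bit unsigned values, each consisting of two 64-bit machine words. The native quotient certificate is the following Boolean check performed with fixed-width word arithmetic: compute the widening product of the two-word values $q$ and $d$ as a four-word (256-bit) value; add $r$ to it by four-word addition, yielding a 256-bit sum $u$ (the sum modulo $2^{256}$) and a carry-out bit $c$; form the four-word value of the numerator $n$ shifted left by $s$ bits; and accept if and only if (i) the carry $c$ is zero, (ii) $u$ equals the four-word shifted numerator, and (iii) the two-word comparison $r<d$ holds. -}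

module Defs where

open import Data.Bool using (Bool; false; not; _∧_; _∨_; if_then_else_)
open import Data.Fin using (Fin; toℕ)
open import Data.Fin.Properties using (_≟_)
open import Data.Nat using (ℕ; zero; suc; NonZero; _+_; _*_; _^_; _/_; _%_; _≤ᵇ_; _<ᵇ_)
open import Data.Nat.DivMod using (_mod_)
open import Data.Nat.Properties using (m^n≢0)
open import Data.Product using (_×_; _,_)
open import Data.Vec using (Vec; []; _∷_; _++_; head; tail; replicate)
open import Data.Vec.Properties using (≡-dec)
open import Relation.Nullary.Decidable using (does)

-- Multi-word unsigned arithmetic.  A k-word value is a vector of k words,
-- least significant word first.
module WordArithmetic (w : ℕ) .{{_ : NonZero w}} where

  β : ℕ
  β = 2 ^ w

  instance
    β≢0 : NonZero β
    β≢0 = m^n≢0 2 w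

  Word : Set
  Word = Fin β

  Words : ℕ → Set
  Words = Vec Word

  low high : ℕ → Word
  low  v = v mod β
  high v = (v / β) mod β

  zeros : ∀ k → Words k
  zeros k = replicate k (low 0)

  -- Truncates modulo β ^ k.
  toWords : ∀ k → ℕ → Words k
  toWords zero    v = []
  toWords (suc k) v = low v ∷ toWords k (v / β)

  equal : ∀ {k} → Words k → Words k → Bool
  equal xs ys = does (≡-dec _≟_ xs ys)

  less : ∀ {k} → Words k → Words k → Bool
  less []       []       = false
  less (x ∷ xs) (y ∷ ys) = less xs ys ∨ (equal xs ys ∧ (toℕ x <ᵇ toℕ y))

  -- Ripple-carry addition, from a carry-in to a carry-out.
  addC : ∀ {k} → Bool → Words k → Words k → Words k × Bool
  addC c []       []       = [] , c
  addC c (x ∷ xs) (y ∷ ys) =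
    let t        = toℕ x + toℕ y + (if c then 1 else 0)
        zs , out = addC (β ≤ᵇ t) xs ys
    in low t ∷ zs , out

  add : ∀ {k} → Words k → Words k → Words k × Bool
  add = addC false

  -- Words of  x · ys + as + c.  Each step fits in two words, since
  -- (β - 1)² + 2 (β - 1) = β² - 1.
  mulRow : ∀ {k} → Word → Words k → Words k → Word → Words (suc k)
  mulRow x []       []       c = c ∷ []
  mulRow x (y ∷ ys) (a ∷ as) c =
    let t = toℕ x * toℕ y + toℕ a + toℕ c
    in low t ∷ mulRow x ys as (high t)

  -- Schoolbook widening product: words of  xs · ys + as.
  mulAcc : ∀ {j k} → Words j → Words k → Words k → Words (j + k)
  mulAcc []       ys as = as
  mulAcc (x ∷ xs) ys as =
    let zs = mulRow x ys as (low 0)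
    in head zs ∷ mulAcc xs ys (tail zs)

  mul : ∀ {j k} → Words j → Words k → Words (j + k)
  mul xs ys = mulAcc xs ys (zeros _)

  -- Left shift by one whole word, c entering at the bottom.
  shlWord : ∀ {k} → Word → Words k → Words k
  shlWord c []       = []
  shlWord c (x ∷ xs) = c ∷ shlWord x xs

  -- Left shift by b < w bits.  The bits c shifted out of the previous word are
  -- below 2 ^ b, so the addition is a bitwise or.
  shlBits : ∀ {k} → ℕ → Word → Words k → Words k
  shlBits b c []       = []
  shlBits b c (x ∷ xs) =
    let t = toℕ x * 2 ^ b + toℕ c
    in low t ∷ shlBits b (high t) xs

  shlWords : ∀ {k} → ℕ → Words k → Words k
  shlWords zero    xs = xs
  shlWords (suc m) xs = shlWord (low 0) (shlWords m xs)

  shl : ∀ {k} → ℕ → Words k → Words k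
  shl s xs = shlBits (s % w) (low 0) (shlWords (s / w) xs)

  extend : Words 2 → Words 4
  extend xs = xs ++ zeros 2

  certificate : (n : Words 2) (s : ℕ) (d q r : Words 2) → Bool
  certificate n s d q r =
    let u , c = add (mul q d) (extend r)
    in not c ∧ equal u (shl s (extend n)) ∧ less r d

-- Each natural is stored in two 64-bit words, which loses nothing below 2 ^ 128.
nativeCertificate : (n s d q r : ℕ) → Bool
nativeCertificate n s d q r =
  certificate (toWords 2 n) s (toWords 2 d) (toWords 2 q) (toWords 2 r)
  where open WordArithmetic 64

{-# OPTIONS --safe #-}
module Submission where

-- Every word-level operation is exact up to an explicit overflow term o · β ^ k.
-- The certificate's sum has carry 0, and n · 2 ^ s < 2 ^ 256 leaves no overflow in
-- the shift, so acceptance gives q · d + r = n · 2 ^ s in ℕ with r < d, and Euclidean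
-- division is unique.

open import Data.Bool using (Bool; true; false; if_then_else_)
open import Data.Fin using (toℕ)
open import Data.Fin.Properties using (toℕ<n; toℕ-fromℕ<; _≟_)
open import Data.Nat
  using (ℕ; zero; suc; NonZero; >-nonZero; _+_; _*_; _^_; _/_; _%_; _≤_; _<_; _≤ᵇ_; z≤n; s≤s)
open import Data.Nat.DivMod
open import Data.Nat.Properties hiding (_≟_)
open import Data.Nat.Tactic.RingSolver using (solve-∀)
open import Data.Bool.Properties using (T-≡)
open import Data.Product using (Σ-syntax; ∃-syntax; _×_; _,_; proj₁; proj₂)
open import Data.Sum using (_⊎_; inj₁; inj₂)
open import Data.Vec using ([]; _∷_; _++_; head; tail)
open import Data.Vec.Properties using (≡-dec)
open import Function using (Equivalence)
open import Relation.Binary.PropositionalEquality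
  using (_≡_; refl; sym; trans; cong; cong₂; subst; module ≡-Reasoning)
open import Relation.Nullary using (yes; contradiction)
open import Relation.Nullary.Reflects using (ofʸ; ofⁿ)
open import Defs

-- Digit bounds and carry identities over ℕ.

bit : Bool → ℕ
bit c = if c then 1 else 0

bit≤1 : ∀ c → bit c ≤ 1
bit≤1 false = z≤n
bit≤1 true  = s≤s z≤n

-- With B = b + 1 the extreme value b² + 2b is exactly one below B². A product step with two addends
-- therefore fits in two words.
mulAdd<B² : ∀ {B x y a c} → x < B → y < B → a < B → c < B → x * y + a + c < B * B
mulAdd<B² {suc b} {x} {y} {a} {c} (s≤s x≤b) (s≤s y≤b) (s≤s a≤b) (s≤s c≤b) = begin-strict
  x * y + a + c ≤⟨ +-mono-≤ (+-mono-≤ (*-mono-≤ x≤b y≤b) a≤b) c≤b ⟩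
  b * b + b + b <⟨ n<1+n _ ⟩
  suc (b * b + b + b) ≡⟨ square b ⟩
  suc b * suc b ∎
  where
  open ≤-Reasoning
  square : ∀ b → suc (b * b + b + b) ≡ suc b * suc b
  square = solve-∀

-- The extreme value is 2B - 1, so a carry-in of one bit again produces a carry-out of one bit.
add<2B : ∀ {B x y c} → x < B → y < B → c ≤ 1 → x + y + c < B + B
add<2B {suc b} {x} {y} {c} (s≤s x≤b) (s≤s y≤b) c≤1 = begin-strict
  x + y + c ≤⟨ +-mono-≤ (+-mono-≤ x≤b y≤b) c≤1 ⟩
  b + b + 1 <⟨ n<1+n _ ⟩
  suc (b + b + 1) ≡⟨ twice b ⟩
  suc b + suc b ∎
  where
  open ≤-Reasoning
  twice : ∀ b → suc (b + b + 1) ≡ suc b + suc b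
  twice = solve-∀

-- A gap of one in the higher part is worth a full B, which exceeds any low digit x; hence y may be
-- arbitrary.
digits-mono-< : ∀ {B x X Y} y → x < B → X < Y → x + X * B < y + Y * B
digits-mono-< {B} {x} {X} {Y} y x<B X<Y = begin-strict
  x + X * B <⟨ +-monoˡ-< (X * B) x<B ⟩
  suc X * B ≤⟨ *-monoˡ-≤ B X<Y ⟩
  Y * B     ≤⟨ m≤n+m (Y * B) y ⟩
  y + Y * B ∎
  where open ≤-Reasoning

-- Rereads an overflow beyond k + 1 words as an overflow beyond the upper k words, the form in which
-- an induction hypothesis applies.
factor-overflow : ∀ l z B o P → l + z * B + o * (B * P) ≡ l + (z + o * P) * B
factor-overflow = solve-∀

-- Moves the carry h from the upper words back beside the low digit l, so that the two recombine
-- into the step total l + h * B.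
emit-carry : ∀ l v h B → l + (v + h) * B ≡ l + h * B + v * B
emit-carry = solve-∀

-- A nonzero multiple of M would already push the left side up to M, above b.
no-overflow : ∀ {a b M} o → b < M → a + o * M ≡ b → a ≡ b
no-overflow zero    b<M eq = trans (sym (+-identityʳ _)) eq
no-overflow {a} {b} {M} (suc o) b<M eq = contradiction b<M (≤⇒≯ (begin
  M               ≤⟨ m≤m+n M (o * M) ⟩
  suc o * M       ≤⟨ m≤n+m (suc o * M) a ⟩
  a + suc o * M   ≡⟨ eq ⟩
  b ∎))
  where open ≤-Reasoning

module _ (w : ℕ) .{{_ : NonZero w}} where
  open WordArithmetic w

  -- Numerical value of word vectors and digit splitting.

  value : ∀ {k} → Words k → ℕ
  value []       = 0
  value (x ∷ xs) = toℕ x + value xs * β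

  toℕ-low : ∀ v → toℕ (low v) ≡ v % β
  toℕ-low v = toℕ-fromℕ< (m%n<n v β)

  toℕ-low-< : ∀ {v} → v < β → toℕ (low v) ≡ v
  toℕ-low-< {v} v<β = trans (toℕ-low v) (m<n⇒m%n≡m v<β)

  -- `high` truncates as well; the bound makes t / β a single digit, so that truncation changes
  -- nothing.
  low+high : ∀ {t} → t < β * β → toℕ (low t) + toℕ (high t) * β ≡ t
  low+high {t} t<β² = begin
    toℕ (low t) + toℕ (high t) * β
      ≡⟨ cong₂ (λ l h → l + h * β) (toℕ-low t) (toℕ-low-< (m<n*o⇒m/o<n t<β²)) ⟩
    t % β + t / β * β ≡⟨ m≡m%n+[m/n]*n t β ⟨
    t ∎
    where open ≡-Reasoning

  -- Below 2β the quotient by β is 0 or 1, and the test `β ≤ᵇ t` computes it.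
  low+carry : ∀ {t} → t < β + β → toℕ (low t) + bit (β ≤ᵇ t) * β ≡ t
  low+carry {t} t<2β with β ≤ᵇ t | ≤ᵇ-reflects-≤ β t
  ... | false | ofⁿ β≰t = trans (+-identityʳ _) (toℕ-low-< (≰⇒> β≰t))
  -- Writing t as β + o turns t < β + β into o < β by cancellation, so o is the low digit.
  ... | true  | ofʸ β≤t with m≤n⇒∃[o]m+o≡n β≤t
  ...   | o , refl = begin
    toℕ (low (β + o)) + 1 * β ≡⟨ cong (toℕ (low (β + o)) +_) (*-identityˡ β) ⟩
    toℕ (low (β + o)) + β     ≡⟨ cong (_+ β) (toℕ-low (β + o)) ⟩
    (β + o) % β + β           ≡⟨ cong (λ v → v % β + β) (+-comm β o) ⟩
    (o + β) % β + β           ≡⟨ cong (_+ β) ([m+n]%n≡m%n o β) ⟩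
    o % β + β                 ≡⟨ cong (_+ β) (m<n⇒m%n≡m (+-cancelˡ-< β o β t<2β)) ⟩
    o + β                     ≡⟨ +-comm o β ⟩
    β + o ∎
    where open ≡-Reasoning

  value-toWords : ∀ k {v} → v < β ^ k → value (toWords k v) ≡ v
  value-toWords zero    (s≤s z≤n) = refl
  value-toWords (suc k) {v} v<βᵏ⁺¹ = begin
    toℕ (low v) + value (toWords k (v / β)) * β
      ≡⟨ cong₂ (λ l h → l + h * β) (toℕ-low v) (value-toWords k v/β<βᵏ) ⟩
    v % β + v / β * β ≡⟨ m≡m%n+[m/n]*n v β ⟨
    v ∎
    where
    open ≡-Reasoning
    v/β<βᵏ : v / β < β ^ k
    v/β<βᵏ = m<n*o⇒m/o<n (subst (v <_) (*-comm β (β ^ k)) v<βᵏ⁺¹)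

  value-zeros : ∀ k → value (zeros k) ≡ 0
  value-zeros zero    = refl
  value-zeros (suc k) =
    cong₂ (λ l h → l + h * β) (toℕ-low-< (m^n>0 2 w)) (value-zeros k)

  value-++-zeros : ∀ {j} (xs : Words j) k → value (xs ++ zeros k) ≡ value xs
  value-++-zeros []       k = value-zeros k
  value-++-zeros (x ∷ xs) k = cong (λ v → toℕ x + v * β) (value-++-zeros xs k)

  -- Soundness of the comparisons.

  equal-sound : ∀ {k} (xs ys : Words k) → equal xs ys ≡ true → xs ≡ ys
  -- A `no` would turn the hypothesis into `false ≡ true`, so `yes` is the only case.
  equal-sound xs ys _ with yes xs≡ys ← ≡-dec _≟_ xs ys = xs≡ys

  less-sound : ∀ {k} (xs ys : Words k) → less xs ys ≡ true → value xs < value ys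
  less-sound [] [] ()
  less-sound (x ∷ xs) (y ∷ ys) h with less xs ys in xs<ys
  ... | true = digits-mono-< (toℕ y) (toℕ<n x) (less-sound xs ys xs<ys)
  ... | false with equal xs ys in xs≡ys
  -- The upper words agree, so the lowest words decide.
  ...   | true with refl ← equal-sound xs ys xs≡ys =
    +-monoˡ-< (value xs * β) (<ᵇ⇒< (toℕ x) (toℕ y) (Equivalence.from T-≡ h))

  -- Addition and the widening product.

  value-addC : ∀ {k} c (xs ys : Words k) → let zs , out = addC c xs ys in
    value zs + bit out * β ^ k ≡ value xs + value ys + bit c
  value-addC c []       []       = *-identityʳ (bit c)
  value-addC {suc k} c (x ∷ xs) (y ∷ ys) = begin
    toℕ (low t) + value zs * β + bit out * (β * β ^ k)
      ≡⟨ factor-overflow (toℕ (low t)) (value zs) β (bit out) (β ^ k) ⟩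
    toℕ (low t) + (value zs + bit out * β ^ k) * β
      ≡⟨ cong (λ v → toℕ (low t) + v * β) (value-addC (β ≤ᵇ t) xs ys) ⟩
    toℕ (low t) + (value xs + value ys + bit (β ≤ᵇ t)) * β
      ≡⟨ emit-carry (toℕ (low t)) (value xs + value ys) (bit (β ≤ᵇ t)) β ⟩
    toℕ (low t) + bit (β ≤ᵇ t) * β + (value xs + value ys) * β
      ≡⟨ cong (_+ (value xs + value ys) * β) (low+carry (add<2B (toℕ<n x) (toℕ<n y) (bit≤1 c))) ⟩
    t + (value xs + value ys) * β
      ≡⟨ regroup (toℕ x) (toℕ y) (bit c) (value xs) (value ys) β ⟩
    (toℕ x + value xs * β) + (toℕ y + value ys * β) + bit c ∎
    where
    open ≡-Reasoning
    t   = toℕ x + toℕ y + bit c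
    zs  = proj₁ (addC (β ≤ᵇ t) xs ys)
    out = proj₂ (addC (β ≤ᵇ t) xs ys)
    regroup : ∀ x y c X Y B → x + y + c + (X + Y) * B ≡ (x + X * B) + (y + Y * B) + c
    regroup = solve-∀

  -- No overflow term appears: each step total is below β², and the final carry is kept as the extra
  -- top word.
  value-mulRow : ∀ {k} x (ys as : Words k) c →
    value (mulRow x ys as c) ≡ toℕ x * value ys + value as + toℕ c
  value-mulRow x [] [] c = trans (+-identityʳ (toℕ c)) (vanish (toℕ x) (toℕ c))
    where
    vanish : ∀ x c → c ≡ x * 0 + 0 + c
    vanish = solve-∀
  value-mulRow x (y ∷ ys) (a ∷ as) c = begin
    toℕ (low t) + value (mulRow x ys as (high t)) * β
      ≡⟨ cong (λ v → toℕ (low t) + v * β) (value-mulRow x ys as (high t)) ⟩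
    toℕ (low t) + (toℕ x * value ys + value as + toℕ (high t)) * β
      ≡⟨ emit-carry (toℕ (low t)) (toℕ x * value ys + value as) (toℕ (high t)) β ⟩
    toℕ (low t) + toℕ (high t) * β + (toℕ x * value ys + value as) * β
      ≡⟨ cong (_+ (toℕ x * value ys + value as) * β)
           (low+high (mulAdd<B² (toℕ<n x) (toℕ<n y) (toℕ<n a) (toℕ<n c))) ⟩
    t + (toℕ x * value ys + value as) * β
      ≡⟨ regroup (toℕ x) (toℕ y) (toℕ a) (toℕ c) (value ys) (value as) β ⟩
    toℕ x * (toℕ y + value ys * β) + (toℕ a + value as * β) + toℕ c ∎
    where
    open ≡-Reasoning
    t = toℕ x * toℕ y + toℕ a + toℕ c
    regroup : ∀ x y a c Y A B →
      x * y + a + c + (x * Y + A) * B ≡ x * (y + Y * B) + (a + A * B) + c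
    regroup = solve-∀

  value-head-tail : ∀ {k} (zs : Words (suc k)) → value zs ≡ toℕ (head zs) + value (tail zs) * β
  value-head-tail (z ∷ zs) = refl

  -- The head of each row is a finished digit of the result; its tail, one factor β higher, is the
  -- accumulator for the next word of `xs`.
  value-mulAcc : ∀ {j k} (xs : Words j) (ys as : Words k) →
    value (mulAcc xs ys as) ≡ value xs * value ys + value as
  value-mulAcc []       ys as = refl
  value-mulAcc (x ∷ xs) ys as = begin
    toℕ (head zs) + value (mulAcc xs ys (tail zs)) * β
      ≡⟨ cong (λ v → toℕ (head zs) + v * β) (value-mulAcc xs ys (tail zs)) ⟩
    toℕ (head zs) + (value xs * value ys + value (tail zs)) * β
      ≡⟨ emit-carry (toℕ (head zs)) (value xs * value ys) (value (tail zs)) β ⟩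
    toℕ (head zs) + value (tail zs) * β + value xs * value ys * β
      ≡⟨ cong (_+ value xs * value ys * β)
           (trans (sym (value-head-tail zs)) (value-mulRow x ys as (low 0))) ⟩
    toℕ x * value ys + value as + toℕ (low 0) + value xs * value ys * β
      ≡⟨ cong (λ c → toℕ x * value ys + value as + c + value xs * value ys * β)
           (toℕ-low-< (m^n>0 2 w)) ⟩
    toℕ x * value ys + value as + 0 + value xs * value ys * β
      ≡⟨ regroup (toℕ x) (value xs) (value ys) (value as) β ⟩
    (toℕ x + value xs * β) * value ys + value as ∎
    where
    open ≡-Reasoning
    zs = mulRow x ys as (low 0)
    regroup : ∀ x X Y A B → x * Y + A + 0 + X * Y * B ≡ (x + X * B) * Y + A
    regroup = solve-∀

  value-mul : ∀ {j k} (xs : Words j) (ys : Words k) → value (mul xs ys) ≡ value xs * value ys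
  value-mul {k = k} xs ys = begin
    value (mul xs ys)                     ≡⟨ value-mulAcc xs ys (zeros k) ⟩
    value xs * value ys + value (zeros k) ≡⟨ cong (value xs * value ys +_) (value-zeros k) ⟩
    value xs * value ys + 0               ≡⟨ +-identityʳ _ ⟩
    value xs * value ys ∎
    where open ≡-Reasoning

  -- Left shifts, with the part pushed off the top recorded as o.

  value-shlWord : ∀ {k} c (xs : Words k) →
    ∃[ o ] value (shlWord c xs) + o * β ^ k ≡ toℕ c + value xs * β
  value-shlWord c []       = toℕ c , trans (*-identityʳ (toℕ c)) (sym (+-identityʳ (toℕ c)))
  value-shlWord {suc k} c (x ∷ xs) with value-shlWord x xs
  ... | o , eq = o , trans (factor-overflow (toℕ c) (value (shlWord x xs)) β o (β ^ k))
                           (cong (λ v → toℕ c + v * β) eq)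

  value-shlWords : ∀ {k} m (xs : Words k) →
    ∃[ o ] value (shlWords m xs) + o * β ^ k ≡ value xs * β ^ m
  value-shlWords zero    xs = 0 , trans (+-identityʳ (value xs)) (sym (*-identityʳ (value xs)))
  value-shlWords {k} (suc m) xs
    with value-shlWords m xs | value-shlWord (low 0) (shlWords m xs)
  -- The overflow o of the earlier shifts is itself scaled by β, and o′ is the word dropped now.
  ... | o , eq | o′ , eq′ = o′ + o * β , (begin
    value zs + (o′ + o * β) * β ^ k
      ≡⟨ split (value zs) o′ o β (β ^ k) ⟩
    value zs + o′ * β ^ k + o * β ^ k * β
      ≡⟨ cong (_+ o * β ^ k * β) eq′ ⟩
    toℕ (low 0) + value ys * β + o * β ^ k * β
      ≡⟨ cong (λ c → c + value ys * β + o * β ^ k * β) (toℕ-low-< (m^n>0 2 w)) ⟩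
    value ys * β + o * β ^ k * β
      ≡⟨ *-distribʳ-+ β (value ys) (o * β ^ k) ⟨
    (value ys + o * β ^ k) * β
      ≡⟨ cong (_* β) eq ⟩
    value xs * β ^ m * β
      ≡⟨ rotate (value xs) (β ^ m) β ⟩
    value xs * β ^ suc m ∎)
    where
    open ≡-Reasoning
    ys = shlWords m xs
    zs = shlWord (low 0) ys
    split : ∀ z o′ o B P → z + (o′ + o * B) * P ≡ z + o′ * P + o * P * B
    split = solve-∀
    rotate : ∀ x P B → x * P * B ≡ x * (B * P)
    rotate = solve-∀

  value-shlBits : ∀ {k b} → b < w → ∀ c (xs : Words k) →
    ∃[ o ] value (shlBits b c xs) + o * β ^ k ≡ value xs * 2 ^ b + toℕ c
  value-shlBits b<w c []       = toℕ c , *-identityʳ (toℕ c)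
  value-shlBits {suc k} {b} b<w c (x ∷ xs)
    with value-shlBits b<w (high (toℕ x * 2 ^ b + toℕ c)) xs
  ... | o , eq = o , (begin
    toℕ (low t) + value zs * β + o * (β * β ^ k)
      ≡⟨ factor-overflow (toℕ (low t)) (value zs) β o (β ^ k) ⟩
    toℕ (low t) + (value zs + o * β ^ k) * β
      ≡⟨ cong (λ v → toℕ (low t) + v * β) eq ⟩
    toℕ (low t) + (value xs * 2 ^ b + toℕ (high t)) * β
      ≡⟨ emit-carry (toℕ (low t)) (value xs * 2 ^ b) (toℕ (high t)) β ⟩
    toℕ (low t) + toℕ (high t) * β + value xs * 2 ^ b * β
      ≡⟨ cong (_+ value xs * 2 ^ b * β) (low+high t<β²) ⟩
    t + value xs * 2 ^ b * β
      ≡⟨ regroup (toℕ x) (2 ^ b) (toℕ c) (value xs) β ⟩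
    (toℕ x + value xs * β) * 2 ^ b + toℕ c ∎)
    where
    open ≡-Reasoning
    t  = toℕ x * 2 ^ b + toℕ c
    zs = shlBits b (high t) xs
    t<β² : t < β * β
    -- The shift by b < w bits is multiplication by 2 ^ b < β, so the product bound applies with its
    -- other addend set to 0.
    t<β² = subst (λ v → v + toℕ c < β * β) (+-identityʳ (toℕ x * 2 ^ b))
      (mulAdd<B² (toℕ<n x) (^-monoʳ-< 2 (s≤s (s≤s z≤n)) b<w) (m^n>0 2 w) (toℕ<n c))
    regroup : ∀ x p c X B → x * p + c + X * p * B ≡ (x + X * B) * p + c
    regroup = solve-∀

  -- Whole-word and residual bit shifts compose to s because s = s % w + (s / w) * w.
  β^[s/w]*2^[s%w] : ∀ s → β ^ (s / w) * 2 ^ (s % w) ≡ 2 ^ s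
  β^[s/w]*2^[s%w] s = begin
    β ^ (s / w) * 2 ^ (s % w)       ≡⟨ cong (_* 2 ^ (s % w)) (^-*-assoc 2 w (s / w)) ⟩
    2 ^ (w * (s / w)) * 2 ^ (s % w) ≡⟨ ^-distribˡ-+-* 2 (w * (s / w)) (s % w) ⟨
    2 ^ (w * (s / w) + s % w)       ≡⟨ cong (2 ^_) (+-comm (w * (s / w)) (s % w)) ⟩
    2 ^ (s % w + w * (s / w))       ≡⟨ cong (λ m → 2 ^ (s % w + m)) (*-comm w (s / w)) ⟩
    2 ^ (s % w + s / w * w)         ≡⟨ cong (2 ^_) (m≡m%n+[m/n]*n s w) ⟨
    2 ^ s ∎
    where open ≡-Reasoning

  value-shl-mod : ∀ {k} s (xs : Words k) →
    ∃[ o ] value (shl s xs) + o * β ^ k ≡ value xs * 2 ^ s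
  value-shl-mod {k} s xs
    with value-shlWords (s / w) xs
       | value-shlBits (m%n<n s w) (low 0) (shlWords (s / w) xs)
  -- Words lost in the whole-word stage are scaled by the later bit shift; o′ is lost in the bit
  -- shift itself.
  ... | o , eq | o′ , eq′ = o′ + o * 2 ^ b , (begin
    value zs + (o′ + o * 2 ^ b) * β ^ k
      ≡⟨ split (value zs) o′ o (2 ^ b) (β ^ k) ⟩
    value zs + o′ * β ^ k + o * β ^ k * 2 ^ b
      ≡⟨ cong (_+ o * β ^ k * 2 ^ b) eq′ ⟩
    value ys * 2 ^ b + toℕ (low 0) + o * β ^ k * 2 ^ b
      ≡⟨ cong (λ c → value ys * 2 ^ b + c + o * β ^ k * 2 ^ b) (toℕ-low-< (m^n>0 2 w)) ⟩
    value ys * 2 ^ b + 0 + o * β ^ k * 2 ^ b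
      ≡⟨ collect (value ys) (o * β ^ k) (2 ^ b) ⟩
    (value ys + o * β ^ k) * 2 ^ b
      ≡⟨ cong (_* 2 ^ b) eq ⟩
    value xs * β ^ (s / w) * 2 ^ b
      ≡⟨ *-assoc (value xs) (β ^ (s / w)) (2 ^ b) ⟩
    value xs * (β ^ (s / w) * 2 ^ b)
      ≡⟨ cong (value xs *_) (β^[s/w]*2^[s%w] s) ⟩
    value xs * 2 ^ s ∎)
    where
    open ≡-Reasoning
    b  = s % w
    ys = shlWords (s / w) xs
    zs = shlBits b (low 0) ys
    split : ∀ z o′ o p P → z + (o′ + o * p) * P ≡ z + o′ * P + o * P * p
    split = solve-∀
    collect : ∀ y o p → y * p + 0 + o * p ≡ (y + o) * p
    collect = solve-∀

  value-shl : ∀ {k} s (xs : Words k) → value xs * 2 ^ s < β ^ k →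
    value (shl s xs) ≡ value xs * 2 ^ s
  value-shl s xs fits with value-shl-mod s xs
  ... | o , eq = no-overflow o fits eq

  -- From acceptance to the exact division identity.

  certificate-sound : ∀ n s d q r → value n * 2 ^ s < β ^ 4 →
    certificate n s d q r ≡ true →
    value q * value d + value r ≡ value n * 2 ^ s × value r < value d
  certificate-sound n s d q r fits accepted
    with add (mul q d) (extend r) | value-addC false (mul q d) (extend r)
  -- A set carry, or a failed equality test, would make the whole conjunction false, so only these
  -- branches survive. Without a carry, `sum≡` is an exact equation in ℕ.
  ... | u , false | sum≡ with equal u (shl s (extend n)) in u≡
  ...   | true = (begin
    value q * value d + value r
      ≡⟨ cong₂ _+_ (value-mul q d) (value-++-zeros r 2) ⟨
    value (mul q d) + value (extend r)
      ≡⟨ +-identityʳ _ ⟨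
    value (mul q d) + value (extend r) + 0
      ≡⟨ sum≡ ⟨
    value u + 0
      ≡⟨ +-identityʳ (value u) ⟩
    value u
      ≡⟨ cong value (equal-sound u (shl s (extend n)) u≡) ⟩
    value (shl s (extend n))
      ≡⟨ value-shl s (extend n) (subst (λ v → v * 2 ^ s < β ^ 4) (sym (value-++-zeros n 2)) fits) ⟩
    value (extend n) * 2 ^ s
      ≡⟨ cong (_* 2 ^ s) (value-++-zeros n 2) ⟩
    value n * 2 ^ s ∎) , less-sound r d accepted
    where open ≡-Reasoning

  certificate-toWords-sound : ∀ {n d q r} s →
    n < 2 ^ (w * 2) → d < 2 ^ (w * 2) → q < 2 ^ (w * 2) → r < 2 ^ (w * 2) →
    n * 2 ^ s < 2 ^ (w * 4) →
    certificate (toWords 2 n) s (toWords 2 d) (toWords 2 q) (toWords 2 r) ≡ true →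
    q * d + r ≡ n * 2 ^ s × r < d
  certificate-toWords-sound {n} {d} {q} {r} s n< d< q< r< fits accepted =
    transport (stored n<) (stored d<) (stored q<) (stored r<)
      (subst (n * 2 ^ s <_) (sym (^-*-assoc 2 w 4)) fits) (λ fits′ →
        certificate-sound (toWords 2 n) s (toWords 2 d) (toWords 2 q) (toWords 2 r) fits′ accepted)
    where
    stored : ∀ {v} → v < 2 ^ (w * 2) → value (toWords 2 v) ≡ v
    stored {v} v< = value-toWords 2 (subst (v <_) (sym (^-*-assoc 2 w 2)) v<)
    -- With the stored values generalized to variables, matching on `refl` replaces all four at
    -- once, in the size hypothesis as well as in the conclusion.
    transport : ∀ {n n′ d d′ q q′ r r′ M} → n′ ≡ n → d′ ≡ d → q′ ≡ q → r′ ≡ r →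
      n * 2 ^ s < M →
      (n′ * 2 ^ s < M → q′ * d′ + r′ ≡ n′ * 2 ^ s × r′ < d′) →
      q * d + r ≡ n * 2 ^ s × r < d
    transport refl refl refl refl fits sound = sound fits

-- Uniqueness of Euclidean division and the size of the shifted numerator.

divMod-unique : ∀ {m d q r} .{{_ : NonZero d}} → q * d + r ≡ m → r < d → q ≡ m / d × r ≡ m % d
divMod-unique {d = d} {q} {r} refl r<d = q≡ , r≡
  where
  r≡ : r ≡ (q * d + r) % d
  r≡ = begin
    r               ≡⟨ m<n⇒m%n≡m r<d ⟨
    r % d           ≡⟨ [m+kn]%n≡m%n r q d ⟨
    (r + q * d) % d ≡⟨ cong (_% d) (+-comm r (q * d)) ⟩
    (q * d + r) % d ∎
    where open ≡-Reasoning
  q≡ : q ≡ (q * d + r) / d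
  -- Once the remainders agree, cancelling r and then the factor d leaves the quotients.
  q≡ = *-cancelʳ-≡ q ((q * d + r) / d) d (+-cancelˡ-≡ r _ _ (begin
    r + q * d                                 ≡⟨ +-comm r (q * d) ⟩
    q * d + r                                 ≡⟨ m≡m%n+[m/n]*n (q * d + r) d ⟩
    (q * d + r) % d + (q * d + r) / d * d     ≡⟨ cong (_+ (q * d + r) / d * d) r≡ ⟨
    r + (q * d + r) / d * d ∎))
    where open ≡-Reasoning

shift-fits : ∀ {n} a b {s} → n < 2 ^ a → s ≤ b → n * 2 ^ s < 2 ^ (a + b)
shift-fits {n} a b {s} n<2ᵃ s≤b = begin-strict
  n * 2 ^ s     <⟨ *-monoˡ-< (2 ^ s) {{m^n≢0 2 s}} n<2ᵃ ⟩
  2 ^ a * 2 ^ s ≤⟨ *-monoʳ-≤ (2 ^ a) (^-monoʳ-≤ 2 s≤b) ⟩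
  2 ^ a * 2 ^ b ≡⟨ ^-distribˡ-+-* 2 a b ⟨
  2 ^ (a + b) ∎
  where open ≤-Reasoning

-- Reading 128 as 126 + 2 leaves room for both values of s; together with n < 2 ^ 128 this keeps the
-- shifted numerator below 2 ^ 256.
shift≤128 : ∀ {p s} → p ≤ 126 → s ≡ p ⊎ s ≡ p + 1 → s ≤ 128
shift≤128 p≤126 (inj₁ refl) = m≤n⇒m≤n+o 2 p≤126
shift≤128 p≤126 (inj₂ refl) = +-mono-≤ p≤126 (s≤s z≤n)

theorem5 : (p n d q r s : ℕ) → 64 < p → p ≤ 126
    → n < 2 ^ 128 → d < 2 ^ 128 → q < 2 ^ 128 → r < 2 ^ 128
    → s ≡ p ⊎ s ≡ p + 1
    → nativeCertificate n s d q r ≡ true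
    → Σ[ d≢0 ∈ NonZero d ] (q ≡ _/_ (n * 2 ^ s) d {{d≢0}} × r ≡ _%_ (n * 2 ^ s) d {{d≢0}})
theorem5 p n d q r s _ p≤126 n< d< q< r< s≡ accepted =
  d≢0 , divMod-unique {{d≢0}} (proj₁ sound) (proj₂ sound)
  where
  sound : q * d + r ≡ n * 2 ^ s × r < d
  sound = certificate-toWords-sound 64 s n< d< q< r<
    (shift-fits 128 128 n< (shift≤128 p≤126 s≡)) accepted
  d≢0 : NonZero d
  -- The divisor is nonzero because the accepted comparison puts r strictly below it.
  d≢0 = >-nonZero (≤-trans (s≤s z≤n) (proj₂ sound))
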